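{- Let $A=(1,a_1,\ldots,a_k)$ be an orderly currency with $k\geq 1$. Then $a_j-a_i\in\mathcal{A}(a_1)$ for all $0\leq i<j\leq k$.
   Context: A currency is a finite sequence of integers $A=(a_0,a_1,\ldots,a_k)$ with $1=a_0<a_1<\cdots<a_k$. For an integer amount $c>0$, $\mathrm{opt}_A(c)$ is the minimum number of coins (values from $A$, repetitions allowed) summing to $c$, and $\mathrm{grd}_A(c)$ is the number of coins used by the greedy algorithm, which repeatedly takes the largest coin not exceeding the remaining amount. $A$ is orderly if $\mathrm{opt}_A(c)=\mathrm{grd}_A(c)$ for all integers $c>0$. For an integer $a>0$, $\mathcal{A}(a)=\bigcup_{m=1}^{\infty}\{ma-l: 0\leq l\leq m\}=\{a-1,a\}\cup\{2a-2,2a-1,2a\}\cup\cdots$. -}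

module Defs where

open import Data.Nat using (ℕ; zero; suc; _+_; _*_; _∸_; _≤_; _<_; _⊔_; _≤ᵇ_)
open import Data.Fin using (Fin) renaming (zero to fzero; suc to fsuc; _<_ to _<ᶠ_)
open import Data.Vec using (sum; tabulate)
open import Data.List using (allFin; foldr)
open import Data.Bool using (if_then_else_)
open import Data.Product using (Σ; ∃; _×_; _,_)
open import Relation.Binary.PropositionalEquality using (_≡_)

IsCurrency : (k : ℕ) → (Fin (suc k) → ℕ) → Set
IsCurrency k a = (a fzero ≡ 1) × (∀ (i j : Fin (suc k)) → i <ᶠ j → a i < a j)

Represents : (k : ℕ) → (Fin (suc k) → ℕ) → ℕ → (Fin (suc k) → ℕ) → Set
Represents k a c m = sum (tabulate (λ i → m i * a i)) ≡ c

coins : (k : ℕ) → (Fin (suc k) → ℕ) → ℕ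
coins k m = sum (tabulate m)

IsOpt : (k : ℕ) → (Fin (suc k) → ℕ) → ℕ → ℕ → Set
IsOpt k a c n =
  (Σ (Fin (suc k) → ℕ) λ m → Represents k a c m × coins k m ≡ n)
  × (∀ (m : Fin (suc k) → ℕ) → Represents k a c m → n ≤ coins k m)

largestCoin : (k : ℕ) → (Fin (suc k) → ℕ) → ℕ → ℕ
largestCoin k a c = foldr (λ i acc → if a i ≤ᵇ c then a i ⊔ acc else acc) 0 (allFin (suc k))

grdFuel : (k : ℕ) → (Fin (suc k) → ℕ) → ℕ → ℕ → ℕ
grdFuel k a zero c = 0
grdFuel k a (suc f) zero = 0
grdFuel k a (suc f) (suc c) = suc (grdFuel k a f (suc c ∸ largestCoin k a (suc c)))

-- grd_A(c); fuel c suffices since a_0 = 1 means each step removes ≥ 1.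
grd : (k : ℕ) → (Fin (suc k) → ℕ) → ℕ → ℕ
grd k a c = grdFuel k a c c

Orderly : (k : ℕ) → (Fin (suc k) → ℕ) → Set
Orderly k a = ∀ (c : ℕ) → 0 < c → IsOpt k a c (grd k a c)

InCalA : ℕ → ℕ → Set
InCalA a x = ∃ λ m → ∃ λ l → (1 ≤ m) × (l ≤ m) × (x + l ≡ m * a)

{-# OPTIONS --safe #-}

-- Call a coin b > 1 bad if grd (b − 1) ≤ a₁ − 2. If a_j − a_i = q a₁ + r with
-- 0 < r < a₁, then a_j − 1 = a_i + q a₁ + (r − 1) costs at most q + r coins, so the
-- absence of bad coins gives q + r ≥ a₁ − 1, which is a_j − a_i ∈ 𝒜(a₁).
--
-- Suppose b is the least bad coin. Then b > a₁, and some coin b + ℓ has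
-- 1 ≤ ℓ ≤ a₁ − 1: otherwise greedy pays a₁ coins for b + (a₁ − 1) = (b − 1) + a₁, which
-- can be paid with a₁ − 1. Let C be the first coin followed by a gap exceeding b. For a
-- coin c < C greedy pays c + b as D + u with c < D ≤ C and u = 0 or a coin; since
-- grd (u − 1) ≤ grd (b − 1), minimality of b forces u ≤ 1. Going down from C, all gaps
-- between coins up to C are the same s ∈ {b − 1, b}: if the gap after D is at least a₁,
-- then c + (b + ℓ) = D + (u + ℓ) leaves u + ℓ ∈ {1, a₁}, so u is determined by ℓ, and
-- D = c + s with s = b − u. As s ≥ a₁, this contradicts the gap a₁ − 1 between 1 and a₁.
module Submission where

open import Defs
open import Data.Nat
open import Data.Nat.Properties
open import Data.Nat.DivMod using (_/_; _%_; m≡m%n+[m/n]*n; m%n<n)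
open import Data.Nat.Induction using (<-rec; <-wellFounded)
open import Data.Nat.Tactic.RingSolver using (solve-∀)
open import Data.Fin using (Fin; inject; fromℕ; fromℕ<; toℕ) renaming (zero to fzero; suc to fsuc; _<_ to _<ᶠ_)
import Data.Fin.Properties as Fin
open import Data.Vec using (tabulate) renaming (sum to sumᵛ)
open import Data.List using (List; []; _∷_; foldr; allFin)
open import Data.List.Membership.Propositional using (_∈_)
open import Data.List.Membership.Propositional.Properties using (∈-allFin)
open import Data.List.Relation.Unary.Any using (here; there)
open import Data.Bool using (true; false; if_then_else_; T)
open import Data.Product using (∃; ∃₂; _×_; _,_; proj₁; proj₂)
open import Data.Sum using (_⊎_; inj₁; inj₂)
open import Data.Empty using (⊥; ⊥-elim)
open import Data.Unit using (tt)
open import Induction.WellFounded using (Acc; acc)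
open import Relation.Nullary using (¬_; Dec; yes; no)
open import Relation.Nullary.Decidable using (_×-dec_)
open import Relation.Binary.Definitions using (tri<; tri≈; tri>)
open import Relation.Binary.PropositionalEquality

-- V stands for grd, and suc p for a₁; a coin b is written suc β to avoid b ∸ 1.
module GapArgument
  (Coin : ℕ → Set) (V : ℕ → ℕ) (p : ℕ)
  (one-coin   : Coin 1)
  (a-coin     : Coin (suc p))
  (1≤p        : 1 ≤ p)
  (coin-≥     : ∀ {e} → Coin e → e ≡ 1 ⊎ suc p ≤ e)
  -- The last condition makes `D` the largest coin not exceeding `D + u`, so greedy takes `D` first
  -- and leaves `u`.
  (floor      : ∀ n → 1 ≤ n → ∃₂ λ D u → Coin D × n ≡ D + u × (∀ {e} → Coin e → D < e → D + u < e))
  (V-step     : ∀ {D} u → Coin D → (∀ {e} → Coin e → D < e → D + u < e) → V (D + u) ≡ suc (V u))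
  (V-sub      : ∀ m n → V (m + n) ≤ V m + V n)
  (V0         : V 0 ≡ 0)
  (V≡0⇒≡0     : ∀ n → V n ≡ 0 → n ≡ 0)
  (first-gap  : ∀ b → ∃ λ C → Coin C × (∀ {e} → Coin e → C < e → C + b < e)
                  × (∀ {c} → Coin c → c < C → ∃ λ e → Coin e × c < e × e ≤ c + b))
  where

  V-small : ∀ n → n ≤ p → V n ≡ n
  V-small zero    _   = V0
  V-small (suc n) n<p = trans (V-step n one-coin above) (cong suc (V-small n (<⇒≤ n<p)))
    where
    above : ∀ {e} → Coin e → 1 < e → suc n < e
    above ce 1<e with coin-≥ ce
    ... | inj₁ refl = ⊥-elim (<-irrefl refl 1<e)
    ... | inj₂ p<e  = <-≤-trans (s≤s n<p) p<e

  V-coin : ∀ {e} → Coin e → V e ≡ 1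
  V-coin {e} ce = begin
    V e        ≡⟨ cong V (+-identityʳ e) ⟨
    V (e + 0)  ≡⟨ V-step 0 ce (λ {f} _ → subst (_< f) (sym (+-identityʳ e))) ⟩
    suc (V 0)  ≡⟨ cong suc V0 ⟩
    1          ∎
    where open ≡-Reasoning

  V≤1⇒coin : ∀ n → 1 ≤ n → V n ≤ 1 → Coin n
  V≤1⇒coin n 1≤n Vn≤1 with floor n 1≤n
  ... | D , u , cD , refl , gap =
    subst Coin (trans (sym (+-identityʳ D)) (cong (D +_) (sym u≡0))) cD
    where
    u≡0 : u ≡ 0
    u≡0 = V≡0⇒≡0 u (n≤0⇒n≡0 (s≤s⁻¹ (subst (_≤ 1) (V-step u cD gap) Vn≤1)))

  V-pair : ∀ {c e} → Coin c → Coin e → V (c + e) ≤ 2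
  V-pair {c} {e} cc ce =
    ≤-trans (V-sub c e) (≤-reflexive (cong₂ _+_ (V-coin cc) (V-coin ce)))

  -- The least bad coin

  module LeastBad
    (β : ℕ) (cb : Coin (suc β)) (0<β : 0 < β) (bad : V β < p)
    (least : ∀ {u} → u < β → Coin (suc u) → 0 < u → p ≤ V u)
    where

    private b = suc β

    -- By `coin-≥`, `b` is at least `a₁`; equality would give `V β = p`, which is not bad.
    a≤β : suc p ≤ β
    a≤β with coin-≥ cb
    ... | inj₁ b≡1 = ⊥-elim (<⇒≢ 0<β (sym (suc-injective b≡1)))
    ... | inj₂ (s≤s p≤β) with m≤n⇒m<n∨m≡n p≤β
    ...   | inj₁ p<β  = p<β
    ...   | inj₂ refl = ⊥-elim (<-irrefl (V-small p ≤-refl) bad)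

    1<p : 1 < p
    1<p = ≤-<-trans (n≢0⇒n>0 (λ Vβ≡0 → <⇒≢ 0<β (sym (V≡0⇒≡0 β Vβ≡0)))) bad

    -- The witness is the largest coin not exceeding `b + p`. Its distance from `b` is written
    -- `suc ℓ`, so `ℓ` counts from 0.
    next-coin : ∃ λ ℓ → suc ℓ ≤ p × Coin (b + suc ℓ)
    next-coin with floor (b + p) (s≤s z≤n)
    ... | D , u , cD , eq , gap with <-cmp D b
    ...   | tri< D<b _ _ = ⊥-elim (<⇒≱ (gap cb D<b) (subst (b ≤_) eq (m≤m+n b p)))
    -- Greedy would follow `b` by `p` ones, but `b + p = β + a₁` costs at most `V β + 1 ≤ p`.
    ...   | tri≈ _ refl _ = ⊥-elim (<⇒≱ bad (s≤s⁻¹ (begin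
              suc p            ≡⟨ cong suc (V-small p ≤-refl) ⟨
              suc (V p)        ≡⟨ V-step p cD (λ {e} ce b<e → subst (_< e) (sym eq) (gap ce b<e)) ⟨
              V (b + p)        ≡⟨ cong V (+-suc β p) ⟨
              V (β + suc p)    ≤⟨ V-sub β (suc p) ⟩
              V β + V (suc p)  ≡⟨ cong (V β +_) (V-coin a-coin) ⟩
              V β + 1          ≡⟨ +-comm (V β) 1 ⟩
              suc (V β)        ∎)))
      where open ≤-Reasoning
    ...   | tri> _ _ b<D with m≤n⇒∃[o]m+o≡n b<D
    ...     | ℓ , refl = ℓ , +-cancelˡ-≤ b (suc ℓ) p b+ℓ≤b+p , subst Coin (sym (+-suc b ℓ)) cD
      where
      b+ℓ≤b+p : b + suc ℓ ≤ b + p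
      b+ℓ≤b+p = subst₂ _≤_ (sym (+-suc b ℓ)) (sym eq) (m≤m+n _ u)

    private
      ℓ = proj₁ next-coin
      ℓ<p = proj₁ (proj₂ next-coin)
      cbℓ = proj₂ (proj₂ next-coin)
      C = proj₁ (first-gap b)
      cC = proj₁ (proj₂ (first-gap b))
      C-gap = proj₁ (proj₂ (proj₂ (first-gap b)))
      below-C = proj₂ (proj₂ (proj₂ (first-gap b)))

    b-translate : ∀ {c} → Coin c → c < C →
      ∃₂ λ D u → Coin D × c < D × D ≤ C × c + b ≡ D + u × u ≤ 1
    b-translate {c} cc c<C with floor (c + b) (≤-trans (s≤s z≤n) (m≤n+m b c))
    ... | D , u , cD , eq , gap = D , u , cD , c<D , D≤C , eq , u≤1 u eq gap
      where
      c<D : c < D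
      c<D with below-C cc c<C
      ... | e , ce , c<e , e≤c+b = ≰⇒> λ D≤c →
        <⇒≱ (gap ce (≤-<-trans D≤c c<e)) (subst (e ≤_) eq e≤c+b)
      D≤C : D ≤ C
      D≤C = ≮⇒≥ λ C<D → <⇒≱ (C-gap cD C<D)
        (≤-trans (m≤m+n D u) (subst (_≤ C + b) eq (+-monoˡ-≤ b (<⇒≤ c<C))))
      u≤1 : ∀ u → c + b ≡ D + u → (∀ {e} → Coin e → D < e → D + u < e) → u ≤ 1
      u≤1 zero           _  _   = z≤n
      u≤1 (suc zero)     _  _   = s≤s z≤n
      -- A remainder `u ≥ 2` is a coin, and `D + (u - 1) = c + β` gives `V (u - 1) ≤ V β`. So `u` is
      -- a bad coin smaller than `b`.
      u≤1 (suc (suc u″)) eq gap = ⊥-elim (<⇒≱ bad (≤-trans (least u′<β cu (s≤s z≤n)) Vu′≤Vβ))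
        where
        u′ = suc u″
        c+β≡D+u′ : c + β ≡ D + u′
        c+β≡D+u′ = suc-injective (trans (sym (+-suc c β)) (trans eq (+-suc D u′)))
        u′<β : u′ < β
        u′<β = ≰⇒> λ β≤u′ → <⇒≢ (+-mono-<-≤ c<D β≤u′) c+β≡D+u′
        cu : Coin (suc u′)
        cu = V≤1⇒coin (suc u′) (s≤s z≤n) (s≤s⁻¹ (subst (_≤ 2)
               (trans (cong V eq) (V-step (suc u′) cD gap)) (V-pair cc cb)))
        gap′ : ∀ {e} → Coin e → D < e → D + u′ < e
        gap′ ce D<e = ≤-<-trans (+-monoʳ-≤ D (n≤1+n u′)) (gap ce D<e)
        Vu′≤Vβ : V u′ ≤ V β
        Vu′≤Vβ = s≤s⁻¹ (begin
          suc (V u′)  ≡⟨ V-step u′ cD gap′ ⟨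
          V (D + u′)  ≡⟨ cong V c+β≡D+u′ ⟨
          V (c + β)   ≤⟨ V-sub c β ⟩
          V c + V β   ≡⟨ cong (_+ V β) (V-coin cc) ⟩
          suc (V β)   ∎)
          where open ≤-Reasoning

    -- The value that `u≡δ` forces on the remainder of `b-translate`: 0 when the offset `suc ℓ` is
    -- 1, and 1 when it is larger.
    δ : ℕ → ℕ
    δ zero    = 0
    δ (suc _) = 1

    -- The common gap `b - δ ℓ`, given by cases to avoid truncated subtraction.
    s : ℕ → ℕ
    s zero    = b
    s (suc _) = β

    s+δ≡b : ∀ l → s l + δ l ≡ b
    s+δ≡b zero    = +-identityʳ b
    s+δ≡b (suc _) = +-comm β 1

    a≤s : ∀ l → suc p ≤ s l
    a≤s zero    = m≤n⇒m≤1+n a≤β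
    a≤s (suc _) = a≤β

    -- With `v = u + suc ℓ`, the amount `D + v` is the sum of the coins `c` and `b + suc ℓ`. If
    -- `v < a₁`, greedy takes `D`, so `v` is a coin below `a₁`, that is 1. If `v ≥ a₁`, then
    -- `suc ℓ ≤ p` forces `u = 1`.
    u≡δ : ∀ {c D u} → Coin c → Coin D → (∀ {e} → Coin e → D < e → D + suc p ≤ e) →
      c + b ≡ D + u → u ≤ 1 → u ≡ δ ℓ
    u≡δ {c} {D} {u} cc cD gap eq u≤1 with u + suc ℓ <? suc p
    ... | yes v<a with coin-≥ cv
      where
      cv : Coin (u + suc ℓ)
      cv = V≤1⇒coin _ (≤-trans (s≤s z≤n) (m≤n+m (suc ℓ) u)) (s≤s⁻¹ (begin
        suc (V (u + suc ℓ))  ≡⟨ V-step (u + suc ℓ) cD (λ ce D<e → <-≤-trans (+-monoʳ-< D v<a) (gap ce D<e)) ⟨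
        V (D + (u + suc ℓ))  ≡⟨ cong V (+-assoc D u (suc ℓ)) ⟨
        V (D + u + suc ℓ)    ≡⟨ cong (λ x → V (x + suc ℓ)) eq ⟨
        V (c + b + suc ℓ)    ≡⟨ cong V (+-assoc c b (suc ℓ)) ⟩
        V (c + (b + suc ℓ))  ≤⟨ V-pair cc cbℓ ⟩
        2                    ∎))
        where open ≤-Reasoning
    ...   | inj₂ a≤v = ⊥-elim (<⇒≱ v<a a≤v)
    ...   | inj₁ v≡1 with m+n≡0⇒m≡0 u u+ℓ≡0 | m+n≡0⇒n≡0 u u+ℓ≡0
      where
      u+ℓ≡0 : u + ℓ ≡ 0
      u+ℓ≡0 = suc-injective (trans (sym (+-suc u ℓ)) v≡1)
    ...     | u≡0 | ℓ≡0 = trans u≡0 (cong δ (sym ℓ≡0))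
    u≡δ {c} {D} {u} cc cD gap eq u≤1 | no v≮a = by-ℓ ℓ ℓ<p (≮⇒≥ v≮a)
      where
      by-ℓ : ∀ l → suc l ≤ p → suc p ≤ u + suc l → u ≡ δ l
      -- Offset 1 would give `a₁ ≤ 2`, which `1<p` excludes.
      by-ℓ zero    _   a≤v = ⊥-elim (<⇒≱ 1<p (s≤s⁻¹ (≤-trans a≤v (+-monoˡ-≤ 1 u≤1))))
      by-ℓ (suc l) l<p a≤v = ≤-antisym u≤1
        (+-cancelʳ-≤ (suc (suc l)) 1 u (≤-trans (s≤s l<p) a≤v))

    -- Induction downwards from `C`, on the distance to it. The gap after `D` needed for `u≡δ` is at
    -- least `s ℓ` by induction if `D < C`, and exceeds `b` if `D = C`.
    constant-gap : ∀ {c} → Acc _<_ (C ∸ c) → Coin c → c < C →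
      Coin (c + s ℓ) × (∀ {e} → Coin e → c < e → c + s ℓ ≤ e)
    constant-gap {c} (acc rec) cc c<C with b-translate cc c<C
    ... | D , u , cD , c<D , D≤C , eq , u≤1 = subst Coin D≡c+s cD , λ ce c<e → subst (_≤ _) D≡c+s (D≤ ce c<e)
      where
      above : ∀ {e} → Coin e → c < e → e < C → Coin (e + s ℓ) × (∀ {f} → Coin f → e < f → e + s ℓ ≤ f)
      above ce c<e e<C = constant-gap (rec (∸-monoʳ-< c<e (<⇒≤ e<C))) ce e<C
      D-gap : ∀ {e} → Coin e → D < e → D + suc p ≤ e
      D-gap ce D<e with m≤n⇒m<n∨m≡n D≤C
      ... | inj₁ D<C  = ≤-trans (+-monoʳ-≤ D (a≤s ℓ)) (proj₂ (above cD c<D D<C) ce D<e)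
      ... | inj₂ refl = ≤-trans (+-monoʳ-≤ D (m≤n⇒m≤1+n a≤β)) (<⇒≤ (C-gap ce D<e))
      D≡c+s : D ≡ c + s ℓ
      D≡c+s = +-cancelʳ-≡ (δ ℓ) D (c + s ℓ) (begin
        D + δ ℓ          ≡⟨ cong (D +_) (u≡δ cc cD D-gap eq u≤1) ⟨
        D + u            ≡⟨ eq ⟨
        c + b            ≡⟨ cong (c +_) (s+δ≡b ℓ) ⟨
        c + (s ℓ + δ ℓ)  ≡⟨ +-assoc c (s ℓ) (δ ℓ) ⟨
        c + s ℓ + δ ℓ    ∎)
        where open ≡-Reasoning
      -- A coin `e` strictly between `c` and `D` would by induction have no coin within less than
      -- `s ℓ` above it, but `D = c + s ℓ` is closer.
      D≤ : ∀ {e} → Coin e → c < e → D ≤ e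
      D≤ {e} ce c<e = ≮⇒≥ λ e<D → <⇒≱ (+-monoˡ-< (s ℓ) c<e)
        (subst (e + s ℓ ≤_) D≡c+s (proj₂ (above ce c<e (<-≤-trans e<D D≤C)) cD e<D))

    absurd : ⊥
    absurd = <⇒≱ (s≤s (a≤s ℓ)) (proj₂ (constant-gap (<-wellFounded _) one-coin 1<C) a-coin (s≤s 1≤p))
      where
      1<C : 1 < C
      1<C with coin-≥ cC
      ... | inj₂ a≤C = ≤-trans (s≤s 1≤p) a≤C
      ... | inj₁ C≡1 = ⊥-elim (<⇒≱ (C-gap a-coin (subst (_< suc p) (sym C≡1) (s≤s 1≤p)))
                         (≤-trans (m≤n⇒m≤1+n a≤β) (m≤n+m b C)))

  -- From the absence of bad coins to differences of coins

  no-bad-coin : ∀ β → Coin (suc β) → 0 < β → p ≤ V β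
  no-bad-coin = <-rec _ λ β ih cb 0<β →
    ≮⇒≥ λ bad → LeastBad.absurd β cb 0<β bad (λ u<β → ih u<β)

  private
    V-multiple : ∀ q → V (q * suc p) ≤ q
    V-multiple zero    = ≤-reflexive V0
    V-multiple (suc q) = ≤-trans (V-sub (suc p) (q * suc p))
      (+-mono-≤ (≤-reflexive (V-coin a-coin)) (V-multiple q))

  difference : ∀ {c e} → Coin c → Coin e → c < e → 1 ≤ c → InCalA (suc p) (e ∸ c)
  difference {c} {e} cc ce c<e 1≤c = split (d % suc p) refl
    where
    d = e ∸ c
    q = d / suc p
    d≡ = m≡m%n+[m/n]*n d (suc p)
    split : ∀ r → d % suc p ≡ r → InCalA (suc p) d
    split zero r≡ = q , 0 , n≢0⇒n>0 q≢0 , z≤n , trans (+-identityʳ d) d≡qa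
      where
      d≡qa : d ≡ q * suc p
      d≡qa = trans d≡ (cong (_+ q * suc p) r≡)
      q≢0 : q ≢ 0
      q≢0 q≡0 = m>n⇒m∸n≢0 c<e (trans d≡qa (cong (_* suc p) q≡0))
    -- The difference lies `l = p ∸ r` below the next multiple of `a₁`, the one with `m = suc q`.
    -- The bound `l ≤ m` is what `no-bad-coin` supplies.
    split (suc r) r≡ = suc q , p ∸ r , s≤s z≤n , p∸r≤1+q , x+l≡
      where
      r<p : suc r ≤ p
      r<p = s≤s⁻¹ (subst (_< suc p) r≡ (m%n<n d (suc p)))
      d≡′ : d ≡ suc r + q * suc p
      d≡′ = trans d≡ (cong (_+ q * suc p) r≡)
      β = c + (r + q * suc p)
      e≡ : e ≡ suc β
      e≡ = begin
        e                          ≡⟨ m+[n∸m]≡n (<⇒≤ c<e) ⟨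
        c + d                      ≡⟨ cong (c +_) d≡′ ⟩
        c + suc (r + q * suc p)    ≡⟨ +-suc c _ ⟩
        suc β                      ∎
        where open ≡-Reasoning
      Vβ≤ : V β ≤ r + suc q
      Vβ≤ = begin
        V β                                  ≤⟨ V-sub c _ ⟩
        V c + V (r + q * suc p)              ≤⟨ +-mono-≤ (≤-reflexive (V-coin cc)) (V-sub r _) ⟩
        1 + (V r + V (q * suc p))            ≤⟨ s≤s (+-mono-≤ (≤-reflexive (V-small r (<⇒≤ r<p))) (V-multiple q)) ⟩
        1 + (r + q)                          ≡⟨ +-suc r q ⟨
        r + suc q                            ∎
        where open ≤-Reasoning
      p≤ : p ≤ r + suc q
      p≤ = ≤-trans (no-bad-coin β (subst Coin e≡ ce) (≤-trans 1≤c (m≤m+n c _))) Vβ≤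
      p∸r≤1+q : p ∸ r ≤ suc q
      p∸r≤1+q = m≤n+o⇒m∸n≤o p r p≤
      x+l≡ : d + (p ∸ r) ≡ suc q * suc p
      x+l≡ = begin
        d + (p ∸ r)                      ≡⟨ cong (_+ (p ∸ r)) d≡′ ⟩
        suc r + q * suc p + (p ∸ r)      ≡⟨ +-assoc (suc r) _ _ ⟩
        suc r + (q * suc p + (p ∸ r))    ≡⟨ cong (suc r +_) (+-comm (q * suc p) _) ⟩
        suc r + ((p ∸ r) + q * suc p)    ≡⟨ +-assoc (suc r) _ _ ⟨
        suc (r + (p ∸ r)) + q * suc p    ≡⟨ cong (λ x → suc x + q * suc p) (m+[n∸m]≡n (<⇒≤ r<p)) ⟩
        suc q * suc p                    ∎
        where open ≡-Reasoning

-- Any `h` with the pointwise equation is allowed, so that both coin counts and, through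
-- distributivity, total values are covered.
sum-tabulate-+ : ∀ n (f g h : Fin n → ℕ) → (∀ i → h i ≡ f i + g i) →
  sumᵛ (tabulate h) ≡ sumᵛ (tabulate f) + sumᵛ (tabulate g)
sum-tabulate-+ zero    f g h eq = refl
sum-tabulate-+ (suc n) f g h eq
  rewrite eq fzero | sum-tabulate-+ n (λ i → f (fsuc i)) (λ i → g (fsuc i)) (λ i → h (fsuc i)) (λ i → eq (fsuc i))
  = interchange (f fzero) (g fzero) _ _
  where
  interchange : ∀ w x y z → w + x + (y + z) ≡ w + y + (x + z)
  interchange = solve-∀

-- Properties of the greedy algorithm

module Greedy (k : ℕ) (a : Fin (suc k) → ℕ) (a₀≡1 : a fzero ≡ 1) where

  Coin : ℕ → Set
  Coin n = ∃ λ i → a i ≡ n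

  private
    -- The fold of `largestCoin` over an arbitrary list, for induction on the list.
    best : ℕ → List (Fin (suc k)) → ℕ
    best c = foldr (λ i acc → if a i ≤ᵇ c then a i ⊔ acc else acc) 0

  best-upper : ∀ c xs {i} → i ∈ xs → a i ≤ c → a i ≤ best c xs
  best-upper c (x ∷ xs) i∈ ai≤c with a x ≤ᵇ c in eq
  best-upper c (x ∷ xs) (here refl) ai≤c | true  = m≤m⊔n _ _
  best-upper c (x ∷ xs) (there i∈)  ai≤c | true  = m≤n⇒m≤o⊔n _ (best-upper c xs i∈ ai≤c)
  best-upper c (x ∷ xs) (here refl) ai≤c | false = ⊥-elim (subst T eq (≤⇒≤ᵇ ai≤c))
  best-upper c (x ∷ xs) (there i∈)  ai≤c | false = best-upper c xs i∈ ai≤c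

  -- The value 0 is the start of the fold; for positive amounts the coin 1 rules it out in
  -- `largestCoin-coin`.
  best-attained : ∀ c xs → best c xs ≡ 0 ⊎ (Coin (best c xs) × best c xs ≤ c)
  best-attained c []       = inj₁ refl
  best-attained c (x ∷ xs) with a x ≤ᵇ c in eq
  ... | false = best-attained c xs
  ... | true with best-attained c xs | ≤-total (a x) (best c xs)
  ...   | inj₂ (cb , b≤c) | inj₁ ≤b rewrite m≤n⇒m⊔n≡n ≤b = inj₂ (cb , b≤c)
  ...   | _               | inj₂ ≥b rewrite m≥n⇒m⊔n≡m ≥b = inj₂ ((x , refl) , ≤ᵇ⇒≤ _ _ (subst T (sym eq) tt))
  ...   | inj₁ b≡0        | inj₁ ≤b rewrite m≤n⇒m⊔n≡n ≤b = inj₁ b≡0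

  largestCoin-max : ∀ {c e} → Coin e → e ≤ c → e ≤ largestCoin k a c
  largestCoin-max {c} (i , refl) e≤c = best-upper c (allFin (suc k)) (∈-allFin i) e≤c

  largestCoin-≥1 : ∀ {c} → 1 ≤ c → 1 ≤ largestCoin k a c
  largestCoin-≥1 = largestCoin-max (fzero , a₀≡1)

  largestCoin-coin : ∀ {c} → 1 ≤ c → Coin (largestCoin k a c) × largestCoin k a c ≤ c
  largestCoin-coin {c} 1≤c with best-attained c (allFin (suc k))
  ... | inj₁ ≡0 = ⊥-elim (<⇒≢ (largestCoin-≥1 1≤c) (sym ≡0))
  ... | inj₂ r  = r

  floor : ∀ n → 1 ≤ n → ∃₂ λ D u → Coin D × n ≡ D + u × (∀ {e} → Coin e → D < e → D + u < e)
  floor n 1≤n = D , n ∸ D , proj₁ LC , sym D+u≡n ,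
    λ ce D<e → ≰⇒> λ e≤ → <⇒≱ D<e (largestCoin-max ce (subst (_ ≤_) D+u≡n e≤))
    where
    D = largestCoin k a n
    LC = largestCoin-coin 1≤n
    D+u≡n : D + (n ∸ D) ≡ n
    D+u≡n = m+[n∸m]≡n (proj₂ LC)

  -- The coin 1 makes each step remove at least 1, so fuel that covers the amount still covers the
  -- rest. This lets `grd` recurse although a step may leave more fuel than the rest.
  grdFuel-irrelevant : ∀ f g c → c ≤ f → c ≤ g → grdFuel k a f c ≡ grdFuel k a g c
  grdFuel-irrelevant zero    zero    c       _         _         = refl
  grdFuel-irrelevant zero    (suc g) zero    _         _         = refl
  grdFuel-irrelevant (suc f) zero    zero    _         _         = refl
  grdFuel-irrelevant (suc f) (suc g) zero    _         _         = refl
  grdFuel-irrelevant (suc f) (suc g) (suc c) (s≤s c≤f) (s≤s c≤g) =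
    cong suc (grdFuel-irrelevant f g _ (≤-trans rest≤c c≤f) (≤-trans rest≤c c≤g))
    where
    rest≤c : suc c ∸ largestCoin k a (suc c) ≤ c
    rest≤c = ∸-monoʳ-≤ (suc c) (largestCoin-≥1 (s≤s z≤n))

  grd-largestCoin : ∀ c → 1 ≤ c → grd k a c ≡ suc (grd k a (c ∸ largestCoin k a c))
  grd-largestCoin (suc c) 1≤c = cong suc (grdFuel-irrelevant c _ _ (∸-monoʳ-≤ (suc c) (largestCoin-≥1 1≤c)) ≤-refl)

  grd-step : ∀ {D} u → 1 ≤ D → Coin D → (∀ {e} → Coin e → D < e → D + u < e) →
    grd k a (D + u) ≡ suc (grd k a u)
  grd-step {D} u 1≤D cD gap = begin
    grd k a (D + u)                                    ≡⟨ grd-largestCoin (D + u) 1≤D+u ⟩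
    suc (grd k a (D + u ∸ largestCoin k a (D + u)))    ≡⟨ cong (λ x → suc (grd k a (D + u ∸ x))) L≡D ⟩
    suc (grd k a (D + u ∸ D))                          ≡⟨ cong (λ x → suc (grd k a x)) (m+n∸m≡n D u) ⟩
    suc (grd k a u)                                    ∎
    where
    open ≡-Reasoning
    1≤D+u = ≤-trans 1≤D (m≤m+n D u)
    LC = largestCoin-coin 1≤D+u
    L≡D : largestCoin k a (D + u) ≡ D
    L≡D = ≤-antisym (≮⇒≥ λ D<L → <⇒≱ (gap (proj₁ LC) D<L) (proj₂ LC)) (largestCoin-max cD (m≤m+n D u))

  grd≡0⇒≡0 : ∀ n → grd k a n ≡ 0 → n ≡ 0
  grd≡0⇒≡0 zero    _  = refl
  grd≡0⇒≡0 (suc n) ()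

  -- Optimal representations of the two amounts add up to one of `m + n`, where greedy is optimal.
  -- This is the only use of orderliness; amount 0 is apart because `Orderly` concerns positive
  -- amounts.
  grd-subadditive : Orderly k a → ∀ m n → grd k a (m + n) ≤ grd k a m + grd k a n
  grd-subadditive ord zero    n       = ≤-refl
  grd-subadditive ord (suc m) zero
    rewrite +-identityʳ m | +-identityʳ (grd k a (suc m)) = ≤-refl
  grd-subadditive ord (suc m) (suc n) with ord (suc m) (s≤s z≤n) | ord (suc n) (s≤s z≤n)
  ... | (f , f-sum , f-coins) , _ | (g , g-sum , g-coins) , _ =
    begin
      grd k a (suc m + suc n)                ≤⟨ proj₂ (ord (suc m + suc n) (s≤s z≤n)) h h-sum ⟩
      coins k h                              ≡⟨ sum-tabulate-+ (suc k) f g h (λ _ → refl) ⟩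
      coins k f + coins k g                  ≡⟨ cong₂ _+_ f-coins g-coins ⟩
      grd k a (suc m) + grd k a (suc n)      ∎
    where
    open ≤-Reasoning
    h : Fin (suc k) → ℕ
    h i = f i + g i
    h-sum : Represents k a (suc m + suc n) h
    h-sum = trans (sum-tabulate-+ (suc k) (λ i → f i * a i) (λ i → g i * a i) (λ i → h i * a i)
                    (λ i → *-distribʳ-+ (a i) (f i) (g i)))
                  (cong₂ _+_ f-sum g-sum)

-- Order of the coins and the first large gap

module Increasing (k : ℕ) (a : Fin (suc k) → ℕ) (mono : ∀ i j → i <ᶠ j → a i < a j) where

  a-mono-≤ : ∀ {i j} → toℕ i ≤ toℕ j → a i ≤ a j
  a-mono-≤ i≤j with m≤n⇒m<n∨m≡n i≤j
  ... | inj₁ i<j = <⇒≤ (mono _ _ i<j)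
  ... | inj₂ i≡j = ≤-reflexive (cong a (Fin.toℕ-injective i≡j))

  -- Take the least index whose coin has no larger coin within `b`. One exists, since nothing
  -- exceeds the last coin.
  first-gap : ∀ b → ∃ λ i → (∀ j → a i < a j → a i + b < a j)
    × (∀ j → a j < a i → ∃ λ l → a j < a l × a l ≤ a j + b)
  first-gap b with Fin.¬∀⟶∃¬-smallest (suc k) Followed followed? not-all
    where
    Followed : Fin (suc k) → Set
    Followed i = ∃ λ j → a i < a j × a j ≤ a i + b
    followed? : ∀ i → Dec (Followed i)
    followed? i = Fin.any? λ j → (a i <? a j) ×-dec (a j ≤? a i + b)
    not-all : ¬ (∀ i → Followed i)
    not-all all with all (fromℕ k)
    ... | j , last<j , _ = <⇒≱ last<j (a-mono-≤ (Fin.≤fromℕ j))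
  ... | i , ¬Fi , F< = i , (λ j i<j → ≰⇒> λ j≤ → ¬Fi (j , i<j , j≤)) , below
    where
    below : ∀ j → a j < a i → ∃ λ l → a j < a l × a l ≤ a j + b
    -- `F<` ranges over the type of indices below `i`, so `j` is lowered into it and injected back.
    below j aj<ai = subst (λ x → ∃ λ l → a x < a l × a l ≤ a x + b) inject≡j (F< (fromℕ< j<i))
      where
      j<i : toℕ j < toℕ i
      j<i = ≰⇒> λ i≤j → <⇒≱ aj<ai (a-mono-≤ i≤j)
      inject≡j : inject (fromℕ< j<i) ≡ j
      inject≡j = Fin.toℕ-injective (trans (Fin.toℕ-inject (fromℕ< j<i)) (Fin.toℕ-fromℕ< j<i))

-- The gap argument applied to the greedy algorithm

theorem3p4 : (k : ℕ) → (a : Fin (suc (suc k)) → ℕ) → IsCurrency (suc k) a → Orderly (suc k) a → (i j : Fin (suc (suc k))) → i <ᶠ j → InCalA (a (fsuc fzero)) (a j ∸ a i)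
theorem3p4 k a (a₀≡1 , mono) ord i j i<j = subst (λ x → InCalA x (a j ∸ a i)) (sym a₁≡)
  (GapArgument.difference Coin (grd (suc k) a) p (fzero , a₀≡1) (fsuc fzero , a₁≡) 1≤p
    coin-≥ floor (λ u cD → grd-step u (1≤coin cD) cD) (grd-subadditive ord) refl grd≡0⇒≡0 coin-first-gap
    (i , refl) (j , refl) (mono i j i<j) (1≤coin (i , refl)))
  where
  open Greedy (suc k) a a₀≡1
  open Increasing (suc k) a mono
  p = a (fsuc fzero) ∸ 1
  1<a₁ : 1 < a (fsuc fzero)
  1<a₁ = subst (_< a (fsuc fzero)) a₀≡1 (mono fzero (fsuc fzero) (s≤s z≤n))
  a₁≡ : a (fsuc fzero) ≡ suc p
  a₁≡ = sym (m+[n∸m]≡n (<⇒≤ 1<a₁))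
  1≤p : 1 ≤ p
  1≤p = s≤s⁻¹ (subst (1 <_) a₁≡ 1<a₁)
  1≤coin : ∀ {e} → Coin e → 1 ≤ e
  1≤coin (i , refl) = subst (_≤ a i) a₀≡1 (a-mono-≤ {fzero} {i} z≤n)
  coin-≥ : ∀ {e} → Coin e → e ≡ 1 ⊎ suc p ≤ e
  coin-≥ (fzero  , refl) = inj₁ a₀≡1
  coin-≥ (fsuc i , refl) = inj₂ (subst (_≤ a (fsuc i)) a₁≡ (a-mono-≤ {fsuc fzero} {fsuc i} (s≤s z≤n)))
  coin-first-gap : ∀ b → ∃ λ C → Coin C × (∀ {e} → Coin e → C < e → C + b < e)
    × (∀ {c} → Coin c → c < C → ∃ λ e → Coin e × c < e × e ≤ c + b)
  coin-first-gap b with first-gap b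
  ... | i , gap , below = a i , (i , refl) , (λ { (j , refl) → gap j }) ,
    λ { (j , refl) j<i → let (l , j<l , l≤) = below j j<i in a l , (l , refl) , j<l , l≤ }
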